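{- Let $n, t \in \mathbb{N}$ and let $\mathcal{F} \subseteq \mathcal{P}([n])$ be a nontrivial, union closed family. Then there is an up-set $\mathcal{U} \subseteq \mathcal{P}([n])$ with $\#\mathcal{U} \leq \lceil 2^n / t \rceil$ and $$\#(\mathcal{F} \cap \mathcal{U}) \geq \frac{1}{t} \cdot \#\mathcal{F}.$$
   Context: $[n] = \{1,\dots,n\}$, $\mathcal{P}([n])$ its power set, $\#X$ the cardinality, $\lceil\cdot\rceil$ the ceiling function. $\mathcal{F}$ is nontrivial if $\bigcup_{F \in \mathcal{F}} F = [n]$ and union closed if $A, B \in \mathcal{F}$ implies $A \cup B \in \mathcal{F}$. An up-set is a family $\mathcal{U} \subseteq \mathcal{P}([n])$ such that $A \in \mathcal{U}$ and $A \subseteq B \subseteq [n]$ imply $B \in \mathcal{U}$. -}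

module Defs where

open import Data.Nat using (ℕ; zero; suc; _+_; _∸_; _/_; NonZero)
open import Data.Bool using (Bool; true; T; _∧_)
open import Data.Bool.Properties using (T?)
open import Data.List using (List; []; _∷_; map; _++_; filter; length)
open import Data.Vec using ([]; _∷_)
open import Data.Fin using (Fin)
open import Data.Fin.Subset using (Subset; inside; outside; _∈_; _⊆_; _∪_)
open import Data.Product using (∃; _×_)
open import Relation.Binary.PropositionalEquality using (_≡_)

Family : ℕ → Set
Family n = Subset n → Bool

allSubsets : (n : ℕ) → List (Subset n)
allSubsets zero    = [] ∷ []
allSubsets (suc n) = map (outside ∷_) (allSubsets n) ++ map (inside ∷_) (allSubsets n)

#_ : {n : ℕ} → Family n → ℕ
#_ {n} 𝓕 = length (filter (λ A → T? (𝓕 A)) (allSubsets n))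

_∩ᶠ_ : {n : ℕ} → Family n → Family n → Family n
(𝓕 ∩ᶠ 𝓖) A = 𝓕 A ∧ 𝓖 A

Nontrivial : {n : ℕ} → Family n → Set
Nontrivial {n} 𝓕 = (i : Fin n) → ∃ λ A → 𝓕 A ≡ true × i ∈ A

UnionClosed : {n : ℕ} → Family n → Set
UnionClosed {n} 𝓕 = (A B : Subset n) → 𝓕 A ≡ true → 𝓕 B ≡ true → 𝓕 (A ∪ B) ≡ true

UpSet : {n : ℕ} → Family n → Set
UpSet {n} 𝓤 = (A B : Subset n) → 𝓤 A ≡ true → A ⊆ B → 𝓤 B ≡ true

⌈_/_⌉ : (a t : ℕ) .{{_ : NonZero t}} → ℕ
⌈ a / t ⌉ = (a + (t ∸ 1)) / t

{-# OPTIONS --safe #-}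
-- For a set S that contains a member of 𝓕, the interior of S is the largest member contained in S;
-- let w A be the number of sets with interior A.  Then Σ w A ≤ 2ⁿ over A ∈ 𝓕, and w ⊤ ≤ 1.
-- For members A ⊆ B, the map S ↦ S ─ (B ─ A) injects the sets with interior B into those with
-- interior A, so w B ≤ w A.  Hence the members can be listed by increasing w compatibly with ⊇.
-- Each initial segment of the list contains the interiors of all sets of the up-set it generates,
-- so this up-set has at most Σ w elements.  Take ⊤, which comes first, and the next ⌊(#𝓕 - 1)/t⌋ members:
-- these carry at most the fraction 1/t of the total weight of 𝓕 without ⊤, which gives at most
-- 1 + (2ⁿ - 1)/t sets.
module Submission where

open import Defs
open import Data.Nat using (ℕ; zero; suc; _+_; _*_; _∸_; _/_; _%_; _^_; _≤_; _<_; z≤n; s≤s; NonZero)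
open import Data.Nat.Properties
open import Data.Nat.DivMod using (m/n*n≤m; m*n/n≡m; /-monoˡ-≤; m≡m%n+[m/n]*n; m%n<n)
open import Data.Nat.Tactic.RingSolver using (solve-∀)
open import Data.Nat.ListAction using (sum)
open import Data.Nat.ListAction.Properties using (sum-↭; sum-++)
open import Algebra.Properties.CommutativeSemigroup +-commutativeSemigroup using (x∙yz≈y∙xz)
open import Algebra.Properties.CommutativeSemigroup *-commutativeSemigroup using (xy∙z≈xz∙y)
open import Data.Bool using (Bool; true; false; T; _∧_)
import Data.Bool.Properties as Bool
open import Data.Fin using (Fin)
open import Data.Fin.Subset using (Subset; inside; outside; ⊤; _─_; _∈_; _⊆_; ∣_∣; ⋃)
open import Data.Fin.Subset.Properties
  using (_⊆?_; _∈?_; p⊆p∪q; q⊆p∪q; x∈p∪q⁻; ∪-identityʳ; ∉⊥; ⊆⊤; ⊆-refl; ⊆-trans; ⊆-antisym;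
         p⊂q⇒∣p∣<∣q∣; ∣p∣≤n; p─q⊆p; x∈p∧x∉q⇒x∈p─q; nonempty?)
open import Data.List using (List; []; _∷_; map; _++_; filter; length; take; drop)
open import Data.List.Properties
  using (length-map; length-++; length-take; take++drop≡id; filter-++; filter-all; filter-some; map-++)
open import Data.List.Membership.Propositional using (find; lose) renaming (_∈_ to _∈ˡ_)
open import Data.List.Membership.Propositional.Properties
  using (∈-map⁺; ∈-++⁺ˡ; ∈-++⁺ʳ; ∈-++⁻; ∈-filter⁺; ∈-filter⁻; ∈-map⁻)
open import Data.List.Relation.Unary.All as All using (All; []; _∷_)
import Data.List.Relation.Unary.All.Properties as All
open import Data.List.Relation.Unary.Any using (here; there; any?)
open import Data.List.Relation.Unary.AllPairs using (AllPairs; []; _∷_)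
open import Data.List.Relation.Unary.Unique.Propositional using (Unique)
import Data.List.Relation.Unary.Unique.Propositional.Properties as Unique
open import Data.List.Relation.Binary.Permutation.Propositional using (_↭_; ↭-sym)
open import Data.List.Relation.Binary.Permutation.Propositional.Properties
  using (∈-resp-↭; ↭-length; filter-↭; map⁺)
import Data.List.Sort as Sort
import Data.List.Relation.Unary.Sorted.TotalOrder.Properties as Sorted
open import Data.Product using (∃; _×_; _,_; proj₁; proj₂)
open import Data.Sum using (inj₁; inj₂; [_,_]′)
open import Data.Vec using ([]; _∷_)
open import Data.Vec.Properties using (≡-dec; ∷-injectiveʳ)
open import Function using (_∘_; case_of_; Equivalence)
open import Level using (0ℓ)
open import Relation.Binary using (REL; DecTotalOrder) renaming (Decidable to Decidable₂)
open import Relation.Binary.Definitions using (DecidableEquality)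
import Relation.Binary.Construct.On as On
open import Relation.Binary.PropositionalEquality
  using (_≡_; _≢_; refl; sym; trans; cong; cong₂; subst; module ≡-Reasoning)
open import Relation.Nullary using (¬_; Dec; yes; no; does; contradiction)
open import Relation.Nullary.Decidable using (dec-true)
open import Relation.Unary using (Decidable; Pred)

private variable
  A B : Set
  n : ℕ

does-true⁻ : {P : Set} (P? : Dec P) → does P? ≡ true → P
does-true⁻ (yes p) _ = p

-- Counting in lists

∑ : List A → (A → ℕ) → ℕ
∑ xs f = sum (map f xs)

∑-mono-≤ : (xs : List A) {f g : A → ℕ} → (∀ {x} → x ∈ˡ xs → f x ≤ g x) → ∑ xs f ≤ ∑ xs g
∑-mono-≤ []       f≤g = z≤n
∑-mono-≤ (x ∷ xs) f≤g = +-mono-≤ (f≤g (here refl)) (∑-mono-≤ xs (f≤g ∘ there))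

∑-const-1 : (xs : List A) → ∑ xs (λ _ → 1) ≡ length xs
∑-const-1 []       = refl
∑-const-1 (x ∷ xs) = cong suc (∑-const-1 xs)

∑-zero : (xs : List A) → ∑ xs (λ _ → 0) ≡ 0
∑-zero []       = refl
∑-zero (x ∷ xs) = ∑-zero xs

count : {P : Pred A 0ℓ} → Decidable P → List A → ℕ
count P? xs = length (filter P? xs)

count≤∑ : {P : Pred A 0ℓ} (P? : Decidable P) (xs : List A) {f : A → ℕ} →
          (∀ {x} → P x → 1 ≤ f x) → count P? xs ≤ ∑ xs f
count≤∑ P? []       1≤f = z≤n
count≤∑ P? (x ∷ xs) 1≤f with P? x
... | yes px = +-mono-≤ (1≤f px) (count≤∑ P? xs 1≤f)
... | no _   = ≤-trans (count≤∑ P? xs 1≤f) (m≤n+m _ _)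

module _ {R : REL A B 0ℓ} (R? : Decidable₂ R) where

  count-∷-∑ : ∀ x xs ys → ∑ ys (λ y → count (λ a → R? a y) (x ∷ xs)) ≡
              count (R? x) ys + ∑ ys (λ y → count (λ a → R? a y) xs)
  count-∷-∑ x xs []       = refl
  count-∷-∑ x xs (y ∷ ys) with R? x y | count-∷-∑ x xs ys
  ... | yes _ | ih = cong suc (trans (cong (count (λ a → R? a y) xs +_) ih)
                                     (x∙yz≈y∙xz (count (λ a → R? a y) xs) (count (R? x) ys) _))
  ... | no _  | ih = trans (cong (count (λ a → R? a y) xs +_) ih)
                           (x∙yz≈y∙xz (count (λ a → R? a y) xs) (count (R? x) ys) _)

  -- Both sides count the related pairs, grouped by `y` on the left and by `x` on the right.
  double-count : ∀ xs ys → ∑ ys (λ y → count (λ x → R? x y) xs) ≡ ∑ xs (λ x → count (R? x) ys)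
  double-count []       ys = ∑-zero ys
  double-count (x ∷ xs) ys = trans (count-∷-∑ x xs ys) (cong (count (R? x) ys +_) (double-count xs ys))

count-filter : (f g : A → Bool) (xs : List A) →
               count (Bool.T? ∘ g) (filter (Bool.T? ∘ f) xs) ≡ count (λ x → Bool.T? (f x ∧ g x)) xs
count-filter f g []       = refl
count-filter f g (x ∷ xs) with f x
... | false = count-filter f g xs
... | true with g x
...   | false = count-filter f g xs
...   | true  = cong suc (count-filter f g xs)

count-subsingleton : {P : Pred A 0ℓ} (P? : Decidable P) {xs : List A} → Unique xs →
                     (∀ {x y} → x ∈ˡ xs → y ∈ˡ xs → P x → P y → x ≡ y) → count P? xs ≤ 1
count-subsingleton P? []                    same = z≤n
count-subsingleton P? {x ∷ xs} (x∉xs ∷ uxs) same with P? x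
... | no _   = count-subsingleton P? uxs (λ y∈ z∈ → same (there y∈) (there z∈))
... | yes px with filter P? xs in eq
...   | []    = s≤s z≤n
-- A second entry with the property would equal `x`, which does not recur in `xs`.
...   | y ∷ _ = contradiction (same (here refl) (there y∈xs) px py) (All.lookup x∉xs y∈xs)
  where
  y∈ = ∈-filter⁻ P? {xs = xs} (subst (y ∈ˡ_) (sym eq) (here refl))
  y∈xs = proj₁ y∈
  py = proj₂ y∈

-- Double counting of the pairs with `f x ≡ y`: completeness of `ys` gives each `x` at least one
-- partner, and injectivity gives each `y` at most one.
count-injection : DecidableEquality B → {P : Pred A 0ℓ} (P? : Decidable P) {Q : Pred B 0ℓ} (Q? : Decidable Q)
                  {xs : List A} (ys : List B) → Unique xs → (∀ y → y ∈ˡ ys) →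
                  (f : A → B) → (∀ {x} → P x → Q (f x)) → (∀ {x y} → P x → P y → f x ≡ f y → x ≡ y) →
                  count P? xs ≤ count Q? ys
count-injection _≟_ P? Q? {xs} ys uxs complete f P⇒Q inj = begin
  length pxs                                     ≡⟨ ∑-const-1 pxs ⟨
  ∑ pxs (λ _ → 1)                                ≤⟨ ∑-mono-≤ pxs (λ x∈ → filter-some (f _ ≟_)
                                                      (lose (∈-filter⁺ Q? (complete _) (P⇒Q (holds x∈))) refl)) ⟩
  ∑ pxs (λ x → count (f x ≟_) qys)               ≡⟨ double-count (λ x y → f x ≟ y) pxs qys ⟨
  ∑ qys (λ y → count (λ x → f x ≟ y) pxs)        ≤⟨ ∑-mono-≤ qys (λ {y} _ → count-subsingleton (λ x → f x ≟ y)
                                                      (Unique.filter⁺ P? uxs)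
                                                      (λ x∈ x′∈ e e′ → inj (holds x∈) (holds x′∈) (trans e (sym e′)))) ⟩
  ∑ qys (λ _ → 1)                                ≡⟨ ∑-const-1 qys ⟩
  length qys                                     ∎
  where
  open ≤-Reasoning
  pxs = filter P? xs
  qys = filter Q? ys
  holds = λ {x} (x∈ : x ∈ˡ pxs) → proj₂ (∈-filter⁻ P? {xs = xs} x∈)

-- Comparison of averages without division: sum `f x ≤ f y` over all pairs.
∑-average-≤ : (f : A → ℕ) (xs ys : List A) → (∀ {x y} → x ∈ˡ xs → y ∈ˡ ys → f x ≤ f y) →
              ∑ xs f * length ys ≤ length xs * ∑ ys f
∑-average-≤ f []       ys f≤ = z≤n
∑-average-≤ f (x ∷ xs) ys f≤ = begin
  (f x + ∑ xs f) * length ys             ≡⟨ *-distribʳ-+ (length ys) (f x) _ ⟩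
  f x * length ys + ∑ xs f * length ys   ≤⟨ +-mono-≤ (below ys (f≤ (here refl)))
                                                     (∑-average-≤ f xs ys (λ x∈ → f≤ (there x∈))) ⟩
  ∑ ys f + length xs * ∑ ys f            ∎
  where
  open ≤-Reasoning
  below : ∀ zs → (∀ {z} → z ∈ˡ zs → f x ≤ f z) → f x * length zs ≤ ∑ zs f
  below []       _  = ≤-reflexive (*-zeroʳ (f x))
  below (z ∷ zs) le = ≤-trans (≤-reflexive (*-suc (f x) _)) (+-mono-≤ (le (here refl)) (below zs (le ∘ there)))

AllPairs-++⁻ : {R : REL A A 0ℓ} (xs : List A) {ys : List A} → AllPairs R (xs ++ ys) →
               ∀ {x y} → x ∈ˡ xs → y ∈ˡ ys → R x y
AllPairs-++⁻ (x ∷ xs) (rx ∷ _)   (here refl) y∈ = All.lookup rx (∈-++⁺ʳ xs y∈)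
AllPairs-++⁻ (x ∷ xs) (_  ∷ rxs) (there x∈)  y∈ = AllPairs-++⁻ xs rxs x∈ y∈

-- Subsets

_≟ˢ_ : DecidableEquality (Subset n)
_≟ˢ_ = ≡-dec Bool._≟_

∈-allSubsets : (S : Subset n) → S ∈ˡ allSubsets n
∈-allSubsets []            = here refl
∈-allSubsets (outside ∷ S) = ∈-++⁺ˡ (∈-map⁺ _ (∈-allSubsets S))
∈-allSubsets (inside ∷ S)  = ∈-++⁺ʳ (map (outside ∷_) (allSubsets _)) (∈-map⁺ _ (∈-allSubsets S))

allSubsets-unique : ∀ n → Unique (allSubsets n)
allSubsets-unique zero    = [] ∷ []
allSubsets-unique (suc n) =
  Unique.++⁺ (Unique.map⁺ ∷-injectiveʳ (allSubsets-unique n)) (Unique.map⁺ ∷-injectiveʳ (allSubsets-unique n))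
    λ (out , in′) → case ∈-map⁻ _ out , ∈-map⁻ _ in′ of λ { ((_ , _ , refl) , (_ , _ , ())) }

length-allSubsets : ∀ n → length (allSubsets n) ≡ 2 ^ n
length-allSubsets zero    = refl
length-allSubsets (suc n) = begin
  length (map (outside ∷_) S ++ map (inside ∷_) S)           ≡⟨ length-++ (map (outside ∷_) S) ⟩
  length (map (outside ∷_) S) + length (map (inside ∷_) S)   ≡⟨ cong₂ _+_ (length-map _ S) (length-map _ S) ⟩
  length S + length S                                        ≡⟨ cong₂ _+_ (length-allSubsets n) (length-allSubsets n) ⟩
  2 ^ n + 2 ^ n                                              ≡⟨ cong (2 ^ n +_) (+-identityʳ (2 ^ n)) ⟨
  2 ^ suc n                                                  ∎
  where
  open ≡-Reasoning
  S = allSubsets n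

x∈p─q⇒x∉q : ∀ (p q : Subset n) {x} → x ∈ p ─ q → ¬ x ∈ q
x∈p─q⇒x∉q (s ∷ p) (inside  ∷ q) {Fin.zero}  () _
x∈p─q⇒x∉q (s ∷ p) (outside ∷ q) {Fin.zero}  _ ()
x∈p─q⇒x∉q (s ∷ p) (inside  ∷ q) {Fin.suc x} (Data.Vec.there x∈) (Data.Vec.there x∈q) = x∈p─q⇒x∉q p q x∈ x∈q
x∈p─q⇒x∉q (s ∷ p) (outside ∷ q) {Fin.suc x} (Data.Vec.there x∈) (Data.Vec.there x∈q) = x∈p─q⇒x∉q p q x∈ x∈q

⊆-⋃ : {A : Subset n} {As : List (Subset n)} → A ∈ˡ As → A ⊆ ⋃ As
⊆-⋃ {As = A ∷ As} (here refl) = p⊆p∪q (⋃ As)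
⊆-⋃ {As = A ∷ As} (there A∈)  = ⊆-trans (⊆-⋃ A∈) (q⊆p∪q A (⋃ As))

⋃-⊆ : {S : Subset n} (As : List (Subset n)) → (∀ {A} → A ∈ˡ As → A ⊆ S) → ⋃ As ⊆ S
⋃-⊆ []       _  x∈ = contradiction x∈ ∉⊥
⋃-⊆ (A ∷ As) ⊆S x∈ = [ ⊆S (here refl) , ⋃-⊆ As (⊆S ∘ there) ]′ (x∈p∪q⁻ A (⋃ As) x∈)

-- Interiors and weights.

module _ (𝓕 : Family n) where

  members : List (Subset n)
  members = filter (λ A → Bool.T? (𝓕 A)) (allSubsets n)

  ∈-members⁺ : ∀ {A} → 𝓕 A ≡ true → A ∈ˡ members
  ∈-members⁺ {A} FA = ∈-filter⁺ (λ A → Bool.T? (𝓕 A)) (∈-allSubsets A) (Equivalence.from Bool.T-≡ FA)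

  ∈-members⁻ : ∀ {A} → A ∈ˡ members → 𝓕 A ≡ true
  ∈-members⁻ A∈ = Equivalence.to Bool.T-≡ (proj₂ (∈-filter⁻ (λ A → Bool.T? (𝓕 A)) {xs = allSubsets n} A∈))

  inner : Subset n → List (Subset n)
  inner S = filter (_⊆? S) members

  -- A set containing no member gets the default `⋃ [] = ⊥`. In that case `⊥` is not a member, so no
  -- weight of a member counts the set.
  interior : Subset n → Subset n
  interior S = ⋃ (inner S)

  interior⊆ : ∀ S → interior S ⊆ S
  interior⊆ S = ⋃-⊆ (inner S) (λ A∈ → proj₂ (∈-filter⁻ (_⊆? S) {xs = members} A∈))

  ⊆interior : ∀ {A S} → 𝓕 A ≡ true → A ⊆ S → A ⊆ interior S
  ⊆interior {S = S} FA A⊆S = ⊆-⋃ (∈-filter⁺ (_⊆? S) (∈-members⁺ FA) A⊆S)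

  interior-mono : ∀ {S S′} → S ⊆ S′ → interior S ⊆ interior S′
  interior-mono {S} S⊆S′ = ⋃-⊆ (inner S) λ A∈ →
    let A∈members , A⊆S = ∈-filter⁻ (_⊆? S) {xs = members} A∈
    in ⊆interior (∈-members⁻ A∈members) (⊆-trans A⊆S S⊆S′)

  weight : Subset n → ℕ
  weight A = count (λ S → interior S ≟ˢ A) (allSubsets n)

  -- Each set has a single interior, so it is counted in the weight of at most one member.
  ∑-weight-≤ : ∑ members weight ≤ 2 ^ n
  ∑-weight-≤ = begin
    ∑ members weight                                           ≡⟨ double-count (λ S A → interior S ≟ˢ A) (allSubsets n) members ⟩
    ∑ (allSubsets n) (λ S → count (interior S ≟ˢ_) members)    ≤⟨ ∑-mono-≤ (allSubsets n) (λ {S} _ →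
                                                                    count-subsingleton (interior S ≟ˢ_)
                                                                      (Unique.filter⁺ _ (allSubsets-unique n))
                                                                      (λ _ _ e e′ → trans (sym e) e′)) ⟩
    ∑ (allSubsets n) (λ _ → 1)                                 ≡⟨ ∑-const-1 (allSubsets n) ⟩
    length (allSubsets n)                                      ≡⟨ length-allSubsets n ⟩
    2 ^ n                                                      ∎
    where open ≤-Reasoning

  -- An interior lies inside its set, so only `⊤` can have interior `⊤`.
  weight-⊤ : weight ⊤ ≤ 1
  weight-⊤ = count-subsingleton (λ S → interior S ≟ˢ ⊤) (allSubsets-unique n)
    (λ _ _ e e′ → trans (full e) (sym (full e′)))
    where
    full : ∀ {S} → interior S ≡ ⊤ → S ≡ ⊤
    full {S} e = ⊆-antisym ⊆⊤ (subst (_⊆ S) e (interior⊆ S))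

  weight-antitone : ∀ {A B} → 𝓕 A ≡ true → A ⊆ B → weight B ≤ weight A
  weight-antitone {A} {B} FA A⊆B =
    count-injection _≟ˢ_ (λ S → interior S ≟ˢ B) (λ S → interior S ≟ˢ A) (allSubsets n)
      (allSubsets-unique n) ∈-allSubsets shrink interior-shrink injective
    where
    shrink : Subset n → Subset n
    shrink S = S ─ (B ─ A)

    B⊆ : ∀ {S} → interior S ≡ B → B ⊆ S
    B⊆ {S} e = subst (_⊆ S) e (interior⊆ S)

    A⊆shrink : ∀ {S} → interior S ≡ B → A ⊆ shrink S
    A⊆shrink {S} e x∈A = x∈p∧x∉q⇒x∈p─q (B⊆ e (A⊆B x∈A)) (λ x∈ → x∈p─q⇒x∉q B A x∈ x∈A)

    -- By monotonicity the new interior stays inside `B`; it also avoids `B ─ A`, which leaves only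
    -- `A`.
    interior-shrink : ∀ {S} → interior S ≡ B → interior (shrink S) ≡ A
    interior-shrink {S} e = ⊆-antisym below (⊆interior FA (A⊆shrink e))
      where
      below : interior (shrink S) ⊆ A
      below {x} x∈ with x ∈? A
      ... | yes x∈A = x∈A
      ... | no x∉A  = contradiction (x∈p∧x∉q⇒x∈p─q x∈B x∉A) (x∈p─q⇒x∉q S (B ─ A) (interior⊆ (shrink S) x∈))
        where
        x∈B : x ∈ B
        x∈B = subst (x ∈_) e (interior-mono (p─q⊆p S (B ─ A)) x∈)

    -- Inside `B` nothing is lost, since `S′` contains all of `B`; outside `B` shrinking changes
    -- nothing.
    shrink-⊆ : ∀ {S S′} → interior S′ ≡ B → shrink S ≡ shrink S′ → S ⊆ S′
    shrink-⊆ {S} {S′} e′ eq {x} x∈S with x ∈? B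
    ... | yes x∈B = B⊆ e′ x∈B
    ... | no x∉B  = p─q⊆p S′ (B ─ A) (subst (x ∈_) eq (x∈p∧x∉q⇒x∈p─q x∈S (λ x∈ → x∉B (p─q⊆p B A x∈))))

    injective : ∀ {S S′} → interior S ≡ B → interior S′ ≡ B → shrink S ≡ shrink S′ → S ≡ S′
    injective e e′ eq = ⊆-antisym (shrink-⊆ e′ eq) (shrink-⊆ e (sym eq))

  -- Orders by weight, and then by decreasing cardinality.
  key : Subset n → ℕ
  key A = (n ∸ ∣ A ∣) + weight A * suc n

  -- `key` is a two-digit number in base `suc n`: the weight is the leading digit, and the last
  -- digit `n ∸ ∣ A ∣` is at most `n`.
  key-≤⇒weight-≤ : ∀ {A B} → key A ≤ key B → weight A ≤ weight B
  key-≤⇒weight-≤ {A} {B} kA≤kB = ≮⇒≥ λ wB<wA → <⇒≱ (begin-strict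
    key B                         <⟨ +-monoˡ-< (weight B * suc n) (s≤s (m∸n≤m n ∣ B ∣)) ⟩
    suc (weight B) * suc n        ≤⟨ *-monoˡ-≤ (suc n) wB<wA ⟩
    weight A * suc n              ≤⟨ m≤n+m _ (n ∸ ∣ A ∣) ⟩
    key A                         ∎) kA≤kB
    where open ≤-Reasoning

  -- The weight does not grow from `A` to `B`, and if it stays equal the larger cardinality of `B`
  -- decides.
  key-strictly-antitone : ∀ {A B} → 𝓕 A ≡ true → A ⊆ B → A ≢ B → key B < key A
  key-strictly-antitone {A} {B} FA A⊆B A≢B =
    +-mono-<-≤ (∸-monoʳ-< ∣A∣<∣B∣ (∣p∣≤n B)) (*-monoˡ-≤ (suc n) (weight-antitone FA A⊆B))
    where
    ∣A∣<∣B∣ : ∣ A ∣ < ∣ B ∣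
    ∣A∣<∣B∣ with nonempty? (B ─ A)
    ... | yes (x , x∈) = p⊂q⇒∣p∣<∣q∣ (A⊆B , x , p─q⊆p B A x∈ , x∈p─q⇒x∉q B A x∈)
    ... | no  empty    = contradiction (⊆-antisym A⊆B B⊆A) A≢B
      where
      B⊆A : B ⊆ A
      B⊆A {x} x∈B with x ∈? A
      ... | yes x∈A = x∈A
      ... | no  x∉A = contradiction (x , x∈p∧x∉q⇒x∈p─q x∈B x∉A) empty

  -- Up-sets generated by initial segments.

  generated : List (Subset n) → Family n
  generated G S = does (any? (_⊆? S) G)

  generated-upset : ∀ G → UpSet (generated G)
  generated-upset G S S′ S∈ S⊆S′ with find (does-true⁻ (any? (_⊆? S) G) S∈)
  ... | A , A∈ , A⊆S = dec-true (any? (_⊆? S′) G) (lose A∈ (⊆-trans A⊆S S⊆S′))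

  -- Every entry of `G` lies in the up-set it generates, and the permutation carries the count over
  -- to `members`.
  length-≤-#∩ : ∀ G {H} → G ++ H ↭ members → length G ≤ # (𝓕 ∩ᶠ generated G)
  length-≤-#∩ G {H} perm = begin
    length G                                 ≡⟨ cong length (filter-all gen? (All.tabulate self)) ⟨
    count gen? G                             ≤⟨ m≤m+n _ (count gen? H) ⟩
    count gen? G + count gen? H              ≡⟨ length-++ (filter gen? G) ⟨
    length (filter gen? G ++ filter gen? H)  ≡⟨ cong length (filter-++ gen? G H) ⟨
    count gen? (G ++ H)                      ≡⟨ ↭-length (filter-↭ gen? perm) ⟩
    count gen? members                       ≡⟨ count-filter 𝓕 (generated G) (allSubsets n) ⟩
    # (𝓕 ∩ᶠ generated G)                     ∎
    where
    open ≤-Reasoning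
    gen? = λ S → Bool.T? (generated G S)
    self : ∀ {A} → A ∈ˡ G → T (generated G A)
    self {A} A∈ = Equivalence.from Bool.T-≡ (dec-true (any? (_⊆? A) G) (lose A∈ ⊆-refl))

  keyOrder : DecTotalOrder 0ℓ 0ℓ 0ℓ
  keyOrder = On.decTotalOrder ≤-decTotalOrder key

  sorted-members : ∃ λ As → As ↭ members × AllPairs (λ A B → key A ≤ key B) As
  sorted-members = sort members , sort-↭ members ,
                   Sorted.Sorted⇒AllPairs (DecTotalOrder.totalOrder keyOrder) (sort-↗ members)
    where open Sort keyOrder

  module _ (closed : UnionClosed 𝓕) where

    -- The entry `A` rules out the empty list, whose union `⊥` may fail to be a member.
    ⋃-closed : ∀ {A} (As : List (Subset n)) → A ∈ˡ As → (∀ {B} → B ∈ˡ As → 𝓕 B ≡ true) → 𝓕 (⋃ As) ≡ true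
    ⋃-closed (A ∷ [])     _ F = trans (cong 𝓕 (∪-identityʳ A)) (F (here refl))
    ⋃-closed (A ∷ B ∷ As) _ F = closed A _ (F (here refl)) (⋃-closed (B ∷ As) (here refl) (F ∘ there))

    interior-member : ∀ {A S} → 𝓕 A ≡ true → A ⊆ S → 𝓕 (interior S) ≡ true
    interior-member {S = S} FA A⊆S = ⋃-closed (inner S) (∈-filter⁺ (_⊆? S) (∈-members⁺ FA) A⊆S)
      (λ B∈ → ∈-members⁻ (proj₁ (∈-filter⁻ (_⊆? S) {xs = members} B∈)))

    -- The union of all members is a member and covers everything. The given `A` makes the family
    -- nonempty: for `n = 0` the empty family is nontrivial too.
    ⊤-member : ∀ {A} → Nontrivial 𝓕 → 𝓕 A ≡ true → 𝓕 ⊤ ≡ true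
    ⊤-member {A} nontrivial FA = subst (λ S → 𝓕 S ≡ true) (⊆-antisym ⊆⊤ covers)
                                       (⋃-closed members (∈-members⁺ FA) ∈-members⁻)
      where
      covers : ⊤ ⊆ ⋃ members
      covers {x} _ = let (B , FB , x∈B) = nontrivial x in ⊆-⋃ (∈-members⁺ FB) x∈B

    module _ {G H : List (Subset n)} (perm : G ++ H ↭ members)
             (key-≤ : ∀ {A B} → A ∈ˡ G → B ∈ˡ H → key A ≤ key B) where

      private
        G-member : ∀ {A} → A ∈ˡ G → 𝓕 A ≡ true
        G-member A∈ = ∈-members⁻ (∈-resp-↭ perm (∈-++⁺ˡ A∈))

      -- The interior is a member containing `A`. If it differs from `A`, its key is strictly
      -- smaller, so it cannot be listed in `H`.
      interior∈G : ∀ {A S} → A ∈ˡ G → A ⊆ S → interior S ∈ˡ G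
      interior∈G {A} {S} A∈G A⊆S
        with ∈-++⁻ G (∈-resp-↭ (↭-sym perm) (∈-members⁺ (interior-member (G-member A∈G) A⊆S)))
      ... | inj₁ ∈G = ∈G
      ... | inj₂ ∈H with A ≟ˢ interior S
      ...   | yes A≡ = subst (_∈ˡ G) A≡ A∈G
      ...   | no  A≢ = contradiction (key-≤ A∈G ∈H)
                         (<⇒≱ (key-strictly-antitone (G-member A∈G) (⊆interior (G-member A∈G) A⊆S) A≢))

      -- Every generated set has its interior in `G` and is therefore counted by some weight in the
      -- sum.
      #generated-≤ : # generated G ≤ ∑ G weight
      #generated-≤ = begin
        # generated G                                        ≤⟨ count≤∑ (λ S → Bool.T? (generated G S)) (allSubsets n) (λ {S} → 1≤ {S}) ⟩
        ∑ (allSubsets n) (λ S → count (interior S ≟ˢ_) G)    ≡⟨ double-count (λ S A → interior S ≟ˢ A) (allSubsets n) G ⟨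
        ∑ G weight                                           ∎
        where
        open ≤-Reasoning
        1≤ : ∀ {S} → T (generated G S) → 1 ≤ count (interior S ≟ˢ_) G
        1≤ {S} S∈ with find (does-true⁻ (any? (_⊆? S) G) (Equivalence.to Bool.T-≡ S∈))
        ... | A , A∈G , A⊆S = filter-some (interior S ≟ˢ_) (lose (interior∈G A∈G A⊆S) refl)

-- Arithmetic of averages and ceilings.

*-average-≤ : ∀ t {x r k} l → x * l ≤ k * r → k * t ≤ l → (l ≡ 0 → x ≡ 0) → x * t ≤ r
-- With `l = 0` there is no factor to cancel, so the last hypothesis has to settle the claim.
*-average-≤ t         zero      avg kt≤l l≡0⇒x≡0 rewrite l≡0⇒x≡0 refl = z≤n
*-average-≤ t {x} {r} {k} l@(suc _) avg kt≤l _ = *-cancelʳ-≤ (x * t) r l (begin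
  x * t * l       ≡⟨ xy∙z≈xz∙y x t l ⟩
  x * l * t       ≤⟨ *-monoˡ-≤ t avg ⟩
  k * r * t       ≡⟨ xy∙z≈xz∙y k r t ⟩
  k * t * r       ≤⟨ *-monoˡ-≤ r kt≤l ⟩
  l * r           ≡⟨ *-comm l r ⟩
  r * l           ∎)
  where open ≤-Reasoning

-- Since `a ≤ 1`, `a * t` exceeds `a` by at most `t ∸ 1`, exactly the amount that the ceiling adds
-- to the numerator.
⌈/⌉-bound : ∀ t .{{_ : NonZero t}} {a x r N} → a ≤ 1 → a + r ≤ N → x * t ≤ r → a + x ≤ ⌈ N / t ⌉
⌈/⌉-bound t@(suc s) {a} {x} {r} {N} a≤1 a+r≤N xt≤r = begin
  a + x                    ≡⟨ m*n/n≡m (a + x) t ⟨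
  (a + x) * t / t          ≤⟨ /-monoˡ-≤ t bound ⟩
  ⌈ N / t ⌉                ∎
  where
  open ≤-Reasoning
  bound : (a + x) * t ≤ N + s
  bound = begin
    (a + x) * t            ≡⟨ *-distribʳ-+ t a x ⟩
    a * t + x * t          ≤⟨ +-monoʳ-≤ (a * t) xt≤r ⟩
    a * t + r              ≡⟨ split a s r ⟩
    (a + r) + a * s        ≤⟨ +-mono-≤ a+r≤N (*-monoˡ-≤ s a≤1) ⟩
    N + 1 * s              ≡⟨ cong (N +_) (*-identityˡ s) ⟩
    N + s                  ∎
    where
    split : ∀ a s r → a * suc s + r ≡ (a + r) + a * s
    split = solve-∀

theorem3p10 : (n t : ℕ) .{{_ : NonZero t}} (𝓕 : Family n) →
    Nontrivial 𝓕 → UnionClosed 𝓕 →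
    ∃ λ (𝓤 : Family n) → UpSet 𝓤 × # 𝓤 ≤ ⌈ 2 ^ n / t ⌉ × # 𝓕 ≤ t * # (𝓕 ∩ᶠ 𝓤)
theorem3p10 n t 𝓕 nontrivial closed with sorted-members 𝓕
-- For an empty `𝓕` the empty up-set suffices.
... | [] , perm , _ = generated 𝓕 [] , generated-upset 𝓕 [] ,
                      ≤-trans (#generated-≤ 𝓕 closed {[]} {[]} perm (λ ())) z≤n ,
                      ≤-trans (≤-reflexive (sym (↭-length perm))) z≤n
... | A ∷ As , perm , first ∷ sorted = 𝓤 , generated-upset 𝓕 G , #𝓤-bound , #𝓕-bound
  where
  open ≤-Reasoning
  w = weight 𝓕
  -- Rounding down serves both bounds: `k * t ≤ length As` limits the weight of `X`, and
  -- `length As < suc k * t` leaves enough members once `A` is added.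
  k = length As / t
  X = take k As
  Y = drop k As
  G = A ∷ X
  𝓤 = generated 𝓕 G

  X++Y≡As : X ++ Y ≡ As
  X++Y≡As = take++drop≡id k As

  perm′ : G ++ Y ↭ members 𝓕
  perm′ = subst (λ Bs → A ∷ Bs ↭ members 𝓕) (sym X++Y≡As) perm

  sorted′ : AllPairs (λ B C → key 𝓕 B ≤ key 𝓕 C) (G ++ Y)
  sorted′ = subst (λ Bs → AllPairs _ (A ∷ Bs)) (sym X++Y≡As) (first ∷ sorted)

  k≤ : k ≤ length As
  k≤ = ≤-trans (m≤m*n k t) (m/n*n≤m (length As) t)

  length-X : length X ≡ k
  length-X = trans (length-take k As) (m≤n⇒m⊓n≡m k≤)

  FA : 𝓕 A ≡ true
  FA = ∈-members⁻ 𝓕 (∈-resp-↭ perm (here refl))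

  -- Otherwise `⊤` would come later in the list, although its key is strictly smaller than that of
  -- its proper subset `A`.
  A≡⊤ : A ≡ ⊤
  A≡⊤ with A ≟ˢ ⊤ | ∈-resp-↭ (↭-sym perm) (∈-members⁺ 𝓕 (⊤-member 𝓕 closed nontrivial FA))
  ... | yes A≡ | _         = A≡
  ... | no  A≢ | here ⊤≡A  = sym ⊤≡A
  ... | no  A≢ | there ⊤∈  = contradiction (All.lookup first ⊤∈)
                               (<⇒≱ (key-strictly-antitone 𝓕 FA ⊆⊤ A≢))

  ∑As : ∑ X w + ∑ Y w ≡ ∑ As w
  ∑As = trans (sym (sum-++ (map w X) (map w Y)))
              (cong sum (trans (sym (map-++ w X Y)) (cong (map w) X++Y≡As)))

  total : w A + ∑ As w ≤ 2 ^ n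
  total = ≤-trans (≤-reflexive (sum-↭ (map⁺ w perm))) (∑-weight-≤ 𝓕)

  -- The average over `X` is at most that over `Y`. Adding the product of `X` with itself to both
  -- sides compares it with the average over all of `As`.
  average : ∑ X w * length As ≤ k * ∑ As w
  average = begin
    ∑ X w * length As                        ≡⟨ cong (λ Bs → ∑ X w * length Bs) X++Y≡As ⟨
    ∑ X w * length (X ++ Y)                  ≡⟨ cong (∑ X w *_) (length-++ X) ⟩
    ∑ X w * (length X + length Y)            ≡⟨ *-distribˡ-+ (∑ X w) (length X) (length Y) ⟩
    ∑ X w * length X + ∑ X w * length Y      ≤⟨ +-mono-≤ (≤-reflexive (*-comm (∑ X w) (length X)))
                                                  (∑-average-≤ w X Y (λ x∈ y∈ →
                                                    key-≤⇒weight-≤ 𝓕 (AllPairs-++⁻ G sorted′ (there x∈) y∈))) ⟩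
    length X * ∑ X w + length X * ∑ Y w      ≡⟨ *-distribˡ-+ (length X) (∑ X w) (∑ Y w) ⟨
    length X * (∑ X w + ∑ Y w)               ≡⟨ cong₂ _*_ length-X ∑As ⟩
    k * ∑ As w                               ∎

  #𝓤-bound : # 𝓤 ≤ ⌈ 2 ^ n / t ⌉
  #𝓤-bound = ≤-trans (#generated-≤ 𝓕 closed perm′ (AllPairs-++⁻ G sorted′))
    -- Here `a` is the weight of `⊤`, kept out of the averaging, `x` the weight of `X` and `r` that
    -- of `As`.
    (⌈/⌉-bound t (subst (λ B → w B ≤ 1) (sym A≡⊤) (weight-⊤ 𝓕)) total
                 (*-average-≤ t {k = k} (length As) average (m/n*n≤m (length As) t) empty))
    where
    empty : length As ≡ 0 → ∑ X w ≡ 0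
    -- If `As` is empty then `k = 0`, so `X` is empty as well.
    empty e with X | trans length-X (n≤0⇒n≡0 (subst (k ≤_) e k≤))
    ... | [] | _ = refl

  #𝓕-bound : # 𝓕 ≤ t * # (𝓕 ∩ᶠ 𝓤)
  #𝓕-bound = begin
    # 𝓕                        ≡⟨ ↭-length perm ⟨
    suc (length As)            ≡⟨ cong suc (m≡m%n+[m/n]*n (length As) t) ⟩
    -- The remainder is below `t`, so together with the `suc` that stands for `A` it is at most one
    -- further `t`.
    suc (length As % t) + k * t  ≤⟨ +-monoˡ-≤ (k * t) (m%n<n (length As) t) ⟩
    suc k * t                  ≡⟨ *-comm (suc k) t ⟩
    t * suc k                  ≡⟨ cong (λ l → t * suc l) length-X ⟨
    t * length G               ≤⟨ *-monoʳ-≤ t (length-≤-#∩ 𝓕 G perm′) ⟩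
    t * # (𝓕 ∩ᶠ 𝓤)             ∎
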